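{- For every positive integer $k$ there exists a tree $T$ such that $\gamma_g(T)=k$ and $\gamma_g'(T)=k+1$.
   Context: Graphs are finite, simple and nonempty. For a vertex $v$, $N[v]$ is its closed neighborhood; a chosen vertex $v$ dominates all vertices of $N[v]$. The domination game on a graph $G$ is played by two players, Dominator and Staller, who alternately choose vertices of $G$; each chosen vertex must dominate at least one vertex that was not dominated by the previously chosen vertices. The game ends when all vertices of $G$ are dominated. Dominator wants the total number of chosen vertices to be as small as possible, Staller wants it to be as large as possible. The game domination number $\gamma_g(G)$ is the total number of vertices chosen (by both players) when Dominator makes the first move and both players play optimally; the Staller-start game domination number $\gamma_g'(G)$ is the total number of vertices chosen when Staller makes the first move and both players play optimally. -}

module Defs where

open import Data.Fin.Base using (Fin)
import Data.Fin.Properties as Fin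
open import Data.List.Base using (List; []; _∷_; _++_; [_]; length; map; filter; allFin)
open import Data.List.Membership.Propositional using (_∈_)
open import Data.List.Membership.Propositional.Properties
  using (∈-allFin; ∈-map⁺; ∈-filter⁺; ∈-filter⁻)
open import Data.List.Relation.Unary.All as All using (All; []; _∷_)
open import Data.List.Relation.Unary.Any as Any using (Any; here; there; any?)
open import Data.List.Relation.Unary.Linked using (Linked)
open import Data.List.Relation.Unary.Unique.Propositional using (Unique)
open import Data.Nat.Base using (ℕ; suc; _≤_; _≥_; _<_; z≤n; s≤s; s≤s⁻¹)
open import Data.Nat.Properties
  using (≤-refl; ≤-trans; ≤-antisym; ≤-total; <-≤-trans; m≤n⇒m≤1+n)
open import Data.Product.Base using (∃; ∃-syntax; _×_; _,_; proj₁; proj₂)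
open import Data.Sum.Base using (_⊎_; inj₁; inj₂; swap)
open import Function.Base using (_∘_; flip)
open import Function.Bundles using (_↔_; Inverse)
open import Level using (0ℓ)
open import Relation.Binary.Construct.Closure.ReflexiveTransitive using (Star)
open import Relation.Binary.Core using (Rel)
open import Relation.Binary.Definitions as B using (Symmetric; DecidableEquality; Total; Transitive)
open import Relation.Binary.PropositionalEquality
  using (_≡_; refl; sym; trans; cong; subst)
open import Relation.Nullary.Decidable using (Dec; yes; no; map′; _⊎-dec_; _×-dec_; ¬?; decidable-stable)
open import Relation.Nullary.Negation using (¬_; contradiction)
open import Relation.Unary as U using (Pred)

-- Decidability of adjacency is automatic classically; here it is part of
-- what it means for the graph to be finite.
record Graph : Set₁ where
  field
    Vertex   : Set
    order    : ℕ
    finite   : Vertex ↔ Fin order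
    nonempty : Vertex
    Adj      : Rel Vertex 0ℓ
    adj?     : B.Decidable Adj
    adj-sym  : Symmetric Adj
    loopless : ∀ v → ¬ Adj v v

module _ (G : Graph) where
  open Graph G

  Connected : Set
  Connected = ∀ u v → Star Adj u v

  record Cycle : Set where
    field
      start    : Vertex
      rest     : List Vertex
      long     : length rest ≥ 2
      distinct : Unique (start ∷ rest)
      closed   : Linked Adj (start ∷ rest ++ [ start ])

  IsTree : Set
  IsTree = Connected × ¬ Cycle

data Player : Set where
  dominator staller : Player

-- A position of the game is the list of vertices chosen so far, the most
-- recent one first, together with the player to move.
module _ (G : Graph) where
  open Graph G

  _∈N[_] : Vertex → Vertex → Set
  u ∈N[ v ] = u ≡ v ⊎ Adj v u

  Dominated : List Vertex → Vertex → Set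
  Dominated h u = Any (u ∈N[_]) h

  Legal : List Vertex → Vertex → Set
  Legal h v = ∃[ u ] u ∈N[ v ] × ¬ Dominated h u

  Over : List Vertex → Set
  Over h = ∀ u → Dominated h u

  -- Value p h m: with p to move after the choices h, exactly m further
  -- vertices are chosen under optimal play.  Since a legal v excludes Over h,
  -- the constructors do not overlap.
  data Value : Player → List Vertex → ℕ → Set where
    over : ∀ {p h} → Over h → Value p h 0

    dominator-plays : ∀ {h m} v → Legal h v → Value staller (v ∷ h) m →
      (∀ w → Legal h w → ∃[ m′ ] Value staller (w ∷ h) m′ × m ≤ m′) →
      Value dominator h (suc m)

    staller-plays : ∀ {h m} v → Legal h v → Value dominator (v ∷ h) m →
      (∀ w → Legal h w → ∃[ m′ ] Value dominator (w ∷ h) m′ × m ≥ m′) →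
      Value staller h (suc m)

private
  module _ {A : Set} {P Q : Pred A 0ℓ} (P? : U.Decidable P) (Q? : U.Decidable Q)
           (Q⊆P : ∀ {x} → Q x → P x) where

    length-filter-mono : ∀ xs → length (filter Q? xs) ≤ length (filter P? xs)
    length-filter-mono [] = z≤n
    length-filter-mono (x ∷ xs) with Q? x | P? x
    ... | yes q | yes p = s≤s (length-filter-mono xs)
    ... | yes q | no ¬p = contradiction (Q⊆P q) ¬p
    ... | no ¬q | yes p = m≤n⇒m≤1+n (length-filter-mono xs)
    ... | no ¬q | no ¬p = length-filter-mono xs

    length-filter-strict : ∀ {x xs} → x ∈ xs → P x → ¬ Q x →
      length (filter Q? xs) < length (filter P? xs)
    length-filter-strict {x} {xs = _ ∷ xs} (here refl) p ¬q with Q? x | P? x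
    ... | yes q | _     = contradiction q ¬q
    ... | no _  | yes _ = s≤s (length-filter-mono xs)
    ... | no _  | no ¬p = contradiction p ¬p
    length-filter-strict {xs = y ∷ xs} (there x∈) p ¬q with Q? y | P? y
    ... | yes _ | yes _ = s≤s (length-filter-strict x∈ p ¬q)
    ... | yes q | no ¬p = contradiction (Q⊆P q) ¬p
    ... | no _  | yes _ = m≤n⇒m≤1+n (length-filter-strict x∈ p ¬q)
    ... | no _  | no _  = length-filter-strict x∈ p ¬q

  module _ {_⊑_ : Rel ℕ 0ℓ} (⊑-refl : ∀ {m} → m ⊑ m) (⊑-trans : Transitive _⊑_)
           (⊑-total : Total _⊑_) {A : Set} (R : A → ℕ → Set) where

    Best : List A → Set
    Best xs = ∃[ v ] v ∈ xs × ∃[ m ] R v m × All (λ w → ∃[ m′ ] R w m′ × m ⊑ m′) xs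

    best : ∀ {x xs} → All (λ v → ∃ (R v)) (x ∷ xs) → Best (x ∷ xs)
    best ((m , r) ∷ []) = _ , here refl , m , r , (m , r , ⊑-refl) ∷ []
    best ((m , r) ∷ rs@(_ ∷ _)) with best rs
    ... | v , v∈ , n , s , all with ⊑-total m n
    ...   | inj₁ m⊑n = _ , here refl , m , r , (m , r , ⊑-refl) ∷
                       All.map (λ (k , t , n⊑k) → k , t , ⊑-trans m⊑n n⊑k) all
    ...   | inj₂ n⊑m = v , there v∈ , n , s , (m , r , n⊑m) ∷ all

module _ (G : Graph) where
  open Graph G
  open Inverse finite using (to; from; strictlyInverseʳ)

  vertices : List Vertex
  vertices = map from (allFin order)

  ∈-vertices : ∀ v → v ∈ vertices
  ∈-vertices v = subst (_∈ vertices) (strictlyInverseʳ v) (∈-map⁺ from (∈-allFin (to v)))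

  _≟ⱽ_ : DecidableEquality Vertex
  u ≟ⱽ v = map′ (λ e → trans (sym (strictlyInverseʳ u)) (trans (cong from e) (strictlyInverseʳ v)))
                (cong to) (to u Fin.≟ to v)

  ∈N? : ∀ u v → Dec (_∈N[_] G u v)
  ∈N? u v = (u ≟ⱽ v) ⊎-dec adj? v u

  dominated? : ∀ h u → Dec (Dominated G h u)
  dominated? h u = any? (∈N? u) h

  legal? : ∀ h v → Dec (Legal G h v)
  legal? h v = map′ Any.satisfied (λ (u , p) → Any.map (λ { refl → p }) (∈-vertices u))
                    (any? (λ u → ∈N? u v ×-dec ¬? (dominated? h u)) vertices)

  undominated : List Vertex → ℕ
  undominated h = length (filter (¬? ∘ dominated? h) vertices)

  undominated-decreases : ∀ {h v} → Legal G h v → undominated (v ∷ h) < undominated h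
  undominated-decreases {h} {v} (u , u∈ , ¬d) =
    length-filter-strict (¬? ∘ dominated? h) (¬? ∘ dominated? (v ∷ h))
      (λ ¬d′ d → ¬d′ (there d)) (∈-vertices u) ¬d (λ ¬d′ → ¬d′ (here u∈))

  private
    stuck⇒over : ∀ {h} → (∀ v → ¬ Legal G h v) → Over G h
    stuck⇒over {h} stuck u =
      decidable-stable (dominated? h u) (λ ¬d → stuck u (u , inj₁ refl , ¬d))

    value-below : ∀ n p h → undominated h < n → ∃ (Value G p h)
    value-below (suc n) p h h<n =
      choose p (filter (legal? h) vertices) refl
      where
      next : ∀ q {v} → Legal G h v → ∃ (Value G q (v ∷ h))
      next q l = value-below n q _ (<-≤-trans (undominated-decreases l) (s≤s⁻¹ h<n))

      module _ {xs} (eq : filter (legal? h) vertices ≡ xs) where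
        complete : ∀ {v} → Legal G h v → v ∈ xs
        complete {v} l = subst (v ∈_) eq (∈-filter⁺ (legal? h) (∈-vertices v) l)

        sound : ∀ {v} → v ∈ xs → Legal G h v
        sound {v} v∈ = proj₂ (∈-filter⁻ (legal? h) {xs = vertices} (subst (v ∈_) (sym eq) v∈))

      choose : ∀ p xs → filter (legal? h) vertices ≡ xs → ∃ (Value G p h)
      choose p [] eq = 0 , over (stuck⇒over (λ v l → contradiction (complete eq l) λ ()))
      choose dominator (x ∷ xs) eq
        with best ≤-refl ≤-trans ≤-total (λ v → Value G staller (v ∷ h))
                  (All.tabulate (λ v∈ → next staller (sound eq v∈)))
      ... | v , v∈ , m , val , all =
        suc m , dominator-plays v (sound eq v∈) val (λ w l → All.lookup all (complete eq l))
      choose staller (x ∷ xs) eq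
        with best {_⊑_ = _≥_} ≤-refl (flip ≤-trans) (λ m n → swap (≤-total m n))
                  (λ v → Value G dominator (v ∷ h))
                  (All.tabulate (λ v∈ → next dominator (sound eq v∈)))
      ... | v , v∈ , m , val , all =
        suc m , staller-plays v (sound eq v∈) val (λ w l → All.lookup all (complete eq l))

  value-exists : ∀ p h → ∃ (Value G p h)
  value-exists p h = value-below (suc (undominated h)) p h ≤-refl

  value-unique : ∀ {p h m n} → Value G p h m → Value G p h n → m ≡ n
  value-unique (over _) (over _) = refl
  value-unique (over o) (dominator-plays _ (u , _ , ¬d) _ _) = contradiction (o u) ¬d
  value-unique (over o) (staller-plays _ (u , _ , ¬d) _ _) = contradiction (o u) ¬d
  value-unique (dominator-plays _ (u , _ , ¬d) _ _) (over o) = contradiction (o u) ¬d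
  value-unique (staller-plays _ (u , _ , ¬d) _ _) (over o) = contradiction (o u) ¬d
  value-unique (dominator-plays v l x f) (dominator-plays w k y g)
    with f w k | g v l
  ... | _ , y′ , m≤ | _ , x′ , n≤ =
    cong suc (≤-antisym (subst (_ ≤_) (value-unique y′ y) m≤)
                        (subst (_ ≤_) (sym (value-unique x x′)) n≤))
  value-unique (staller-plays v l x f) (staller-plays w k y g)
    with f w k | g v l
  ... | _ , y′ , m≥ | _ , x′ , n≥ =
    cong suc (≤-antisym (subst (_≤ _) (sym (value-unique x x′)) n≥)
                        (subst (_≤ _) (value-unique y′ y) m≥))

  γg : ℕ
  γg = proj₁ (value-exists dominator [])

  γg′ : ℕ
  γg′ = proj₁ (value-exists staller [])

{-# OPTIONS --safe #-}

-- The tree has a centre with two pendant leaves and k − 1 pendant paths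
-- centre – inner i – outer i.  One leaf and the outer vertices have pairwise
-- disjoint closed neighbourhoods, so every game lasts at least k moves, and at
-- least k more moves if Staller opens with the other leaf.  Once the centre is
-- chosen only the k − 1 outer vertices can be undominated, so Dominator bounds
-- the game by taking the centre with his first move: with two leaves, no other
-- single opening move of Staller makes the centre illegal.
module Submission where

open import Defs
open import Data.Fin.Base using (Fin; zero; suc)
import Data.Fin.Properties as Fin
open import Data.List.Base using (List; []; _∷_; _++_; [_]; length; lookup; filter)
open import Data.List.Membership.Propositional using (_∈_)
open import Data.List.Membership.Propositional.Properties using (∈-lookup; ∈-filter⁻)
open import Data.List.Properties using (length-++-comm; ++-assoc)
open import Data.List.Relation.Unary.All as All using (_∷_)
open import Data.List.Relation.Unary.AllPairs using (_∷_)
open import Data.List.Relation.Unary.Any as Any using (Any; here; there; index)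
import Data.List.Relation.Unary.Any.Properties as Any
open import Data.List.Relation.Unary.Linked using (Linked; _∷_)
open import Data.List.Relation.Unary.Unique.Propositional using (Unique)
import Data.List.Relation.Unary.Unique.Propositional.Properties as Unique
open import Data.Maybe.Base using (Maybe; just; nothing)
import Data.Maybe.Properties as Maybe
open import Data.Nat.Base using (ℕ; suc; _+_; _≤_; _≥_; _<_; z≤n; s≤s)
open import Data.Nat.Properties
  using (≤-trans; ≤-reflexive; ≤-antisym; <-trans; <-irrefl; <-asym; m≤n⇒m≤1+n)
open import Data.Product.Base using (Σ-syntax; ∃-syntax; _×_; _,_; proj₁; proj₂)
open import Data.Sum.Base using (_⊎_; inj₁; inj₂; swap)
open import Data.Sum.Function.Propositional using (_⊎-↔_)
import Data.Sum.Properties as Sum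
open import Function.Base using (_∘_)
open import Function.Bundles using (Inverse)
open import Function.Construct.Composition using (_↔-∘_)
open import Function.Construct.Identity using (↔-id)
open import Function.Construct.Symmetry using (↔-sym)
open import Relation.Binary.Construct.Closure.ReflexiveTransitive using (Star; ε; _◅_; _◅◅_; reverse)
open import Relation.Binary.Definitions using (DecidableEquality)
open import Relation.Binary.PropositionalEquality
  using (_≡_; _≢_; refl; sym; trans; cong; subst)
open import Relation.Nullary.Decidable using (yes; no; ¬?; _⊎-dec_)
open import Relation.Nullary.Negation using (¬_; contradiction)

-- Bounds on game values by counting and by single moves

lookup-injective : ∀ {A : Set} {xs : List A} → Unique xs →
  ∀ i j → lookup xs i ≡ lookup xs j → i ≡ j
lookup-injective (_ ∷ _)    zero    zero    _  = refl
lookup-injective (x# ∷ _)   zero    (suc j) eq = contradiction eq (All.lookup x# (∈-lookup j))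
lookup-injective (x# ∷ _)   (suc i) zero    eq = contradiction (sym eq) (All.lookup x# (∈-lookup i))
lookup-injective (_ ∷ uniq) (suc i) (suc j) eq = cong suc (lookup-injective uniq i j eq)

module _ (G : Graph) where
  open Graph G
  open Inverse finite using (from; to; strictlyInverseˡ)

  vertices-unique : Unique (vertices G)
  vertices-unique = Unique.map⁺ from-injective (Unique.allFin⁺ order)
    where
    from-injective : ∀ {i j} → from i ≡ from j → i ≡ j
    from-injective {i} {j} eq =
      trans (sym (strictlyInverseˡ i)) (trans (cong to eq) (strictlyInverseˡ j))

  -- Labelling each entry of the duplicate-free list of undominated vertices by an index of `g` is
  -- injective: equal labels force equal vertices, hence equal positions.
  undominated-≤ : ∀ {n h} (g : Fin n → Vertex) →
    (∀ u → ¬ Dominated G h u → ∃[ i ] u ≡ g i) → undominated G h ≤ n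
  undominated-≤ {h = h} g cover = Fin.injective⇒≤ {f = proj₁ ∘ label} label-injective
    where
    us : List Vertex
    us = filter (¬? ∘ dominated? G h) (vertices G)

    label : ∀ k → ∃[ i ] lookup us k ≡ g i
    label k = cover _ (proj₂ (∈-filter⁻ (¬? ∘ dominated? G h) {xs = vertices G} (∈-lookup k)))

    label-injective : ∀ {k l} → proj₁ (label k) ≡ proj₁ (label l) → k ≡ l
    label-injective {k} {l} eq =
      lookup-injective (Unique.filter⁺ (¬? ∘ dominated? G h) vertices-unique) k l
        (trans (proj₂ (label k)) (trans (cong g eq) (sym (proj₂ (label l)))))

  -- Every legal move dominates a new vertex, so the number of undominated vertices drops by at
  -- least one per move.
  value≤undominated : ∀ {p h m} → Value G p h m → m ≤ undominated G h
  value≤undominated (over _) = z≤n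
  value≤undominated (dominator-plays _ l x _) =
    ≤-trans (s≤s (value≤undominated x)) (undominated-decreases G l)
  value≤undominated (staller-plays _ l x _) =
    ≤-trans (s≤s (value≤undominated x)) (undominated-decreases G l)

  -- Following the optimal moves stored in the derivation of the value yields an actual finished
  -- play, to which counting arguments apply.
  completion : ∀ {p h m} → Value G p h m → ∃[ h′ ] length h′ ≡ m × Over G (h′ ++ h)
  completion {h = h} = λ where
      (over o) → [] , refl , o
      (dominator-plays v _ x _) → extend v (completion x)
      (staller-plays v _ x _) → extend v (completion x)
    where
    extend : ∀ {m} v → ∃[ h′ ] length h′ ≡ m × Over G (h′ ++ v ∷ h) →
             ∃[ h′ ] length h′ ≡ suc m × Over G (h′ ++ h)
    extend v (h′ , len , o) =
      -- Histories list the latest choice first, so `v`, played before all of `h′`, comes last.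
      h′ ++ [ v ] , trans (length-++-comm h′ [ v ]) (cong suc len) ,
      subst (Over G) (sym (++-assoc h′ [ v ] h)) o

  -- In a finished play each `f i` is dominated by some move made after `h`. No vertex dominates two
  -- of them, so these moves occupy distinct positions of `h′`.
  packing≤value : ∀ {n p h m} (f : Fin n → Vertex) →
    (∀ {v i j} → _∈N[_] G (f i) v → _∈N[_] G (f j) v → i ≡ j) →
    (∀ i → ¬ Dominated G h (f i)) → Value G p h m → n ≤ m
  packing≤value {h = h} f packing undom x with completion x
  ... | h′ , refl , o = Fin.injective⇒≤ {f = index ∘ dominator-of} index-injective
    where
    dominator-of : ∀ i → Any (_∈N[_] G (f i)) h′
    dominator-of i with Any.++⁻ h′ (o (f i))
    ... | inj₁ d = d
    ... | inj₂ d = contradiction d (undom i)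

    index-injective : ∀ {i j} → index (dominator-of i) ≡ index (dominator-of j) → i ≡ j
    index-injective {i} {j} eq = packing
      (subst (λ k → _∈N[_] G (f i) (lookup h′ k)) eq (Any.lookup-index (dominator-of i)))
      (Any.lookup-index (dominator-of j))

  -- Dominator's optimal move does at least as well as `w`, so any single legal move gives an upper
  -- bound.
  dominator-≤ : ∀ {h m n} w → Legal G h w →
    (∀ {m′} → Value G staller (w ∷ h) m′ → m′ ≤ n) → Value G dominator h m → m ≤ suc n
  dominator-≤ _ _ _ (over _) = z≤n
  dominator-≤ w l bound (dominator-plays _ _ _ f) with f w l
  ... | _ , x , m≤ = s≤s (≤-trans m≤ (bound x))

  staller-≤ : ∀ {h m n} →
    (∀ w {m′} → Value G dominator (w ∷ h) m′ → m′ ≤ n) → Value G staller h m → m ≤ suc n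
  staller-≤ _ (over _) = z≤n
  staller-≤ bound (staller-plays v _ x _) = s≤s (bound v x)

  -- Dual to `dominator-≤`: one good move of Staller gives a lower bound, and its legality shows
  -- that the game is not over.
  staller-≥ : ∀ {h m n} w → Legal G h w →
    (∀ {m′} → Value G dominator (w ∷ h) m′ → n ≤ m′) → Value G staller h m → suc n ≤ m
  staller-≥ _ (u , _ , ¬d) _ (over o) = contradiction (o u) ¬d
  staller-≥ w l bound (staller-plays _ _ _ f) with f w l
  ... | _ , x , m≥ = s≤s (≤-trans (bound x) m≥)

-- Acyclicity of a graph given by a parent function

module _ {V : Set} (parent : V → Maybe V) where

  Parental : V → V → Set
  Parental u v = parent u ≡ just v ⊎ parent v ≡ just u

  -- A non-backtracking walk never turns upwards after a downward step, so a
  -- closed one would leave and re-enter its start through the same parent.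
  module _ (depth : V → ℕ)
           (depth-parent : ∀ {u v} → parent u ≡ just v → depth u ≡ suc (depth v)) where

    parent-depth< : ∀ {u v} → parent u ≡ just v → depth v < depth u
    parent-depth< e = ≤-reflexive (sym (depth-parent e))

    -- The walk has just descended from `x` to `y`. A step up would return to the vertex just left,
    -- against distinctness, so every step descends, including the last one into `t`.
    fall : ∀ {t x y ys} → parent y ≡ just x → Linked Parental (y ∷ ys ++ [ t ]) →
           Unique (t ∷ x ∷ y ∷ ys) → depth x < depth t × ∃[ p ] p ∈ y ∷ ys × parent t ≡ just p
    fall {ys = []} d (inj₁ u ∷ _) ((t≢x ∷ _) ∷ _) =
      contradiction (Maybe.just-injective (trans (sym u) d)) t≢x
    fall {ys = []} d (inj₂ e ∷ _) _ =
      <-trans (parent-depth< d) (parent-depth< e) , _ , here refl , e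
    fall {ys = _ ∷ _} d (inj₁ u ∷ _) (_ ∷ (_ ∷ x≢z ∷ _) ∷ _) =
      contradiction (Maybe.just-injective (trans (sym d) u)) x≢z
    fall {ys = _ ∷ _} d (inj₂ e ∷ w) ((_ ∷ t#) ∷ _ ∷ u) with fall e w (t# ∷ u)
    ... | y<t , p , p∈ , e′ = <-trans (parent-depth< d) y<t , p , there p∈ , e′

    -- Either every step ascends, making `t` shallower than `y`, or from the first descent on `fall`
    -- applies.
    climb : ∀ {t y ys} → Linked Parental (y ∷ ys ++ [ t ]) → Unique (t ∷ y ∷ ys) →
            depth t < depth y ⊎ ∃[ p ] p ∈ y ∷ ys × parent t ≡ just p
    climb {ys = []} (inj₁ u ∷ _) _ = inj₁ (parent-depth< u)
    climb {ys = []} (inj₂ d ∷ _) _ = inj₂ (_ , here refl , d)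
    climb {ys = _ ∷ _} (inj₂ d ∷ w) uniq with fall d w uniq
    ... | _ , p , p∈ , e = inj₂ (p , there p∈ , e)
    climb {ys = _ ∷ _} (inj₁ u ∷ w) ((_ ∷ t#) ∷ _ ∷ uniq) with climb w (t# ∷ uniq)
    ... | inj₁ t<z = inj₁ (<-trans t<z (parent-depth< u))
    ... | inj₂ (p , p∈ , e) = inj₂ (p , there p∈ , e)

    -- The cases are the directions of the first two steps; distinctness rules out down-up at once.
    no-closed-walk : ∀ {s y z zs} → Linked Parental (s ∷ y ∷ z ∷ zs ++ [ s ]) →
                     ¬ Unique (s ∷ y ∷ z ∷ zs)
    no-closed-walk (inj₂ d ∷ inj₁ u ∷ _) ((_ ∷ s≢z ∷ _) ∷ _) =
      s≢z (Maybe.just-injective (trans (sym d) u))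
    no-closed-walk (inj₂ d ∷ inj₂ e ∷ w) uniq =
      -- The descent ends at `s` deeper than `y`, yet `s` is the parent of `y`.
      <-asym (parent-depth< d) (proj₁ (fall e w uniq))
    no-closed-walk (inj₁ u ∷ inj₂ d ∷ w) uniq@(_ ∷ y# ∷ _) with fall d w uniq
    -- The walk re-enters `s` from its parent, which is `y`, so `y` would be repeated.
    ... | _ , _ , p∈ , e = All.lookup y# p∈ (Maybe.just-injective (trans (sym u) e))
    no-closed-walk (inj₁ u ∷ inj₁ v ∷ w) ((_ ∷ s#) ∷ y# ∷ uniq) with climb w (s# ∷ uniq)
    ... | inj₁ s<z = <-asym s<z (<-trans (parent-depth< v) (parent-depth< u))
    ... | inj₂ (_ , p∈ , e) = All.lookup y# p∈ (Maybe.just-injective (trans (sym u) e))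

-- The spider and its tree structure

module _ (n : ℕ) where

  Node : Set
  Node = Fin 3 ⊎ (Fin n ⊎ Fin n)

  pattern centre  = inj₁ zero
  pattern leaf₁   = inj₁ (suc zero)
  pattern leaf₂   = inj₁ (suc (suc zero))
  pattern inner i = inj₂ (inj₁ i)
  pattern outer i = inj₂ (inj₂ i)

  parent : Node → Maybe Node
  parent centre    = nothing
  parent leaf₁     = just centre
  parent leaf₂     = just centre
  parent (inner _) = just centre
  parent (outer i) = just (inner i)

  depth : Node → ℕ
  depth centre    = 0
  depth leaf₁     = 1
  depth leaf₂     = 1
  depth (inner _) = 1
  depth (outer _) = 2

  depth-parent : ∀ {u v} → parent u ≡ just v → depth u ≡ suc (depth v)
  depth-parent {centre}  ()
  depth-parent {leaf₁}   refl = refl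
  depth-parent {leaf₂}   refl = refl
  depth-parent {inner _} refl = refl
  depth-parent {outer _} refl = refl

  _≟_ : DecidableEquality Node
  _≟_ = Sum.≡-dec Fin._≟_ (Sum.≡-dec Fin._≟_ Fin._≟_)

  spider : Graph
  spider = record
    { Vertex   = Node
    ; order    = 3 + (n + n)
    ; finite   = ↔-sym ((↔-id _ ⊎-↔ Fin.+↔⊎ {n} {n}) ↔-∘ Fin.+↔⊎ {3})
    ; nonempty = centre
    ; Adj      = Parental parent
    ; adj?     = λ u v → Maybe.≡-dec _≟_ (parent u) (just v)
                   ⊎-dec Maybe.≡-dec _≟_ (parent v) (just u)
    ; adj-sym  = swap
    ; loopless = λ where
        v (inj₁ e) → <-irrefl refl (parent-depth< parent depth depth-parent e)
        v (inj₂ e) → <-irrefl refl (parent-depth< parent depth depth-parent e)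
    }

  spider-tree : IsTree spider
  spider-tree = (λ u v → to-centre u ◅◅ reverse swap (to-centre v)) , acyclic
    where
    to-centre : ∀ u → Star (Parental parent) u centre
    to-centre centre    = ε
    to-centre leaf₁     = inj₁ refl ◅ ε
    to-centre leaf₂     = inj₁ refl ◅ ε
    to-centre (inner _) = inj₁ refl ◅ ε
    to-centre (outer _) = inj₁ refl ◅ inj₁ refl ◅ ε

    acyclic : ¬ Cycle spider
    acyclic record { rest = _ ∷ _ ∷ _ ; distinct = uniq ; closed = w } =
      no-closed-walk parent depth depth-parent w uniq
    acyclic record { rest = _ ∷ [] ; long = s≤s () }

  -- The domination game on the spider

  pack : Fin (suc n) → Node
  -- Only one leaf can be packed, since both are adjacent to the centre; `leaf₁` stays free for
  -- Staller's opening.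
  pack zero    = leaf₂
  pack (suc i) = outer i

  -- The index of the only packed vertex that a node can dominate, with an arbitrary value at
  -- `leaf₁`, which dominates none. Such a function shows that the closed neighbourhoods are
  -- disjoint.
  packed : Node → Fin (suc n)
  packed (inj₁ _)  = zero
  packed (inner i) = suc i
  packed (outer i) = suc i

  -- Hence a packed vertex can be dominated only by itself or its parent.
  pack-childless : ∀ v i → parent v ≢ just (pack i)
  pack-childless leaf₁     zero    ()
  pack-childless leaf₁     (suc _) ()
  pack-childless leaf₂     zero    ()
  pack-childless leaf₂     (suc _) ()
  pack-childless (inner _) zero    ()
  pack-childless (inner _) (suc _) ()
  pack-childless (outer _) zero    ()
  pack-childless (outer _) (suc _) ()

  packed-∈N : ∀ {v} i → _∈N[_] spider (pack i) v → packed v ≡ i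
  packed-∈N zero    (inj₁ refl)        = refl
  packed-∈N (suc _) (inj₁ refl)        = refl
  packed-∈N i       (inj₂ (inj₁ e))    = contradiction e (pack-childless _ i)
  packed-∈N zero    (inj₂ (inj₂ refl)) = refl
  packed-∈N (suc _) (inj₂ (inj₂ refl)) = refl

  1+n≤value : ∀ {p h m} → (∀ i → ¬ Dominated spider h (pack i)) → Value spider p h m → suc n ≤ m
  1+n≤value = packing≤value spider pack
    (λ {_} {i} {j} i∈ j∈ → trans (sym (packed-∈N i i∈)) (packed-∈N j j∈))

  value≤n : ∀ {p h m} → centre ∈ h → Value spider p h m → m ≤ n
  value≤n {h = h} c∈ x = ≤-trans (value≤undominated spider x) (undominated-≤ spider outer′ cover)
    where
    outer′ : Fin n → Node
    outer′ i = outer i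

    by-centre : ∀ {u} → _∈N[_] spider u centre → Dominated spider h u
    by-centre u∈ = Any.map (λ { refl → u∈ }) c∈

    cover : ∀ u → ¬ Dominated spider h u → ∃[ i ] u ≡ outer i
    cover centre    ¬d = contradiction (by-centre (inj₁ refl)) ¬d
    cover leaf₁     ¬d = contradiction (by-centre (inj₂ (inj₂ refl))) ¬d
    cover leaf₂     ¬d = contradiction (by-centre (inj₂ (inj₂ refl))) ¬d
    cover (inner _) ¬d = contradiction (by-centre (inj₂ (inj₂ refl))) ¬d
    cover (outer i) _  = i , refl

  -- The witness is a leaf other than `x`: its only neighbour is the centre, so `x` leaves it
  -- undominated.
  centre-legal : ∀ x → x ≢ centre → Legal spider [ x ] centre
  centre-legal centre    x≢c = contradiction refl x≢c
  centre-legal leaf₁     _ = leaf₂ , inj₂ (inj₂ refl) ,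
    λ where (here (inj₁ ())); (here (inj₂ (inj₁ ()))); (here (inj₂ (inj₂ ())))
  centre-legal leaf₂     _ = leaf₁ , inj₂ (inj₂ refl) ,
    λ where (here (inj₁ ())); (here (inj₂ (inj₁ ()))); (here (inj₂ (inj₂ ())))
  centre-legal (inner _) _ = leaf₁ , inj₂ (inj₂ refl) ,
    λ where (here (inj₁ ())); (here (inj₂ (inj₁ ()))); (here (inj₂ (inj₂ ())))
  centre-legal (outer _) _ = leaf₁ , inj₂ (inj₂ refl) ,
    λ where (here (inj₁ ())); (here (inj₂ (inj₁ ()))); (here (inj₂ (inj₂ ())))

  leaf₁-misses-pack : ∀ i → ¬ Dominated spider [ leaf₁ ] (pack i)
  leaf₁-misses-pack zero    (here (inj₂ (inj₁ ())))
  leaf₁-misses-pack zero    (here (inj₂ (inj₂ ())))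
  leaf₁-misses-pack (suc _) (here (inj₂ (inj₁ ())))
  leaf₁-misses-pack (suc _) (here (inj₂ (inj₂ ())))

  γg-spider : γg spider ≡ suc n
  γg-spider = ≤-antisym
    (dominator-≤ spider centre (centre , inj₁ refl , λ ()) (value≤n (here refl)) x)
    (1+n≤value (λ _ ()) x)
    where
    x = proj₂ (value-exists spider dominator [])

  γg′-spider : γg′ spider ≡ suc (suc n)
  γg′-spider = ≤-antisym
    (staller-≤ spider reply x)
    -- Opening at `leaf₁` uses up a move while the whole packing still awaits domination.
    (staller-≥ spider leaf₁ (leaf₁ , inj₁ refl , λ ()) (1+n≤value leaf₁-misses-pack) x)
    where
    x = proj₂ (value-exists spider staller [])

    reply : ∀ w {m} → Value spider dominator [ w ] m → m ≤ suc n
    reply w y with w ≟ centre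
    -- If Staller opens with the centre, at most `n` moves follow, one fewer than the bound allows.
    ... | yes refl = m≤n⇒m≤1+n (value≤n (here refl) y)
    ... | no w≢c = dominator-≤ spider centre (centre-legal w w≢c) (value≤n (here refl)) y

theorem3p1 : ∀ (k : ℕ) → k ≥ 1 → Σ[ T ∈ Graph ] (IsTree T × γg T ≡ k × γg′ T ≡ suc k)
theorem3p1 (suc n) _ = spider n , spider-tree n , γg-spider n , γg′-spider n
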